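{- Define integers $c_X(m)$ and $c_\chi(m)$ by \[ \sum_{m=0}^{\infty}c_X(m)q^m=X(q):=\sum_{n=0}^{\infty}\frac{(-1)^nq^{n^2}}{(-q;q)_{2n}},\qquad \sum_{m=0}^{\infty}c_\chi(m)q^m=\chi(q):=\sum_{n=0}^{\infty}\frac{(-1)^nq^{(n+1)^2}}{(-q;q)_{2n+1}}. \] Then for every $k\in\mathbb{N}$, \[ \sum_{n=0}^{k}\big(b(n)c_X(k-n)+b_1(n)c_\chi(k-n)\big)\equiv0\pmod 2, \] where $b(n)$ is the number of non-Rascoe partitions of $n$ and $b_1(n)$ is the number of generalized non-Rascoe partitions of $n$ associated with $\ell=1$.
   Context: A non-Rascoe partition of $n$ is a partition of $n$ into distinct parts such that the number of parts is not a part; a generalized non-Rascoe partition associated with $\ell=1$ is a partition into distinct parts such that (number of parts) $+1$ is not a part. In both cases the empty partition counts, so $b(0)=b_1(0)=1$. Notation: $(a;q)_n=\prod_{k=0}^{n-1}(1-aq^k)$, $(a;q)_0=1$. -}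

module Defs where

open import Data.Nat as ℕ using (ℕ; zero; suc; _∸_; _≤?_; _≟_)
open import Data.Nat.DivMod using (_/_; _%_)
open import Data.Integer as ℤ using (ℤ; +_; -_)
open import Data.List using (List; []; _∷_; [_]; _++_; map; length; filter)
open import Data.Nat.ListAction using (sum)
open import Data.List.Membership.DecPropositional (_≟_) using (_∈?_)
open import Relation.Nullary using (¬?; yes; no)
open import Relation.Nullary.Decidable using (_×-dec_)

subsetsUpTo : ℕ → List (List ℕ)
subsetsUpTo zero    = [ [] ]
subsetsUpTo (suc k) = subsetsUpTo k ++ map (suc k ∷_) (subsetsUpTo k)

distinctPartitions : ℕ → List (List ℕ)
distinctPartitions n = filter (λ p → sum p ≟ n) (subsetsUpTo n)

b : ℕ → ℕ
b n = length (filter (λ p → ¬? (length p ∈? p)) (distinctPartitions n))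

b₁ : ℕ → ℕ
b₁ n = length (filter (λ p → ¬? (suc (length p) ∈? p)) (distinctPartitions n))

Series : Set
Series = ℕ → ℤ

sumTo : ℕ → (ℕ → ℤ) → ℤ
sumTo zero    f = f 0
sumTo (suc k) f = sumTo k f ℤ.+ f (suc k)

_⋆_ : Series → Series → Series
(f ⋆ g) m = sumTo m (λ i → f i ℤ.* g (m ∸ i))

one : Series
one zero    = + 1
one (suc _) = + 0

sgn : ℕ → ℤ
sgn zero    = + 1
sgn (suc n) = - sgn n

scale : ℤ → Series → Series
scale c f m = c ℤ.* f m

shift : ℕ → Series → Series
shift a f m with a ≤? m
... | yes _ = f (m ∸ a)
... | no  _ = + 0

-- 1/(1+q^(k+1)) = Σ_j (-1)^j q^{(k+1) j}
invOnePlusQPow : ℕ → Series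
invOnePlusQPow k m with m % suc k ≟ 0
... | yes _ = sgn (m / suc k)
... | no  _ = + 0

invPoch : ℕ → Series
invPoch zero    = one
invPoch (suc N) = invPoch N ⋆ invOnePlusQPow N

Xterm : ℕ → Series
Xterm n = scale (sgn n) (shift (n ℕ.* n) (invPoch (2 ℕ.* n)))

χterm : ℕ → Series
χterm n = scale (sgn n) (shift (suc n ℕ.* suc n) (invPoch (suc (2 ℕ.* n))))

-- Coefficients of the infinite sums.  The n-th summand has valuation
-- ≥ n² (resp. (n+1)²) > m whenever n > m, so the coefficient of q^m of
-- the (locally finite) infinite sum is the finite sum over n = 0..m.
cX : Series
cX m = sumTo m (λ n → Xterm n m)

cχ : Series
cχ m = sumTo m (λ n → χterm n m)

{-# OPTIONS --safe #-}
-- Work modulo 2, where −1 = 1, and let N_ℓ be the generating function of the generalized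
-- non-Rascoe partitions associated with ℓ.  Deleting the part ℓ + (number of parts) leads to
--     N_ℓ = N_{ℓ+1} + q^{ℓ+1} N_{ℓ+2}.
-- On the other side W_n = Σ_a q^{a²} / (−q;q)_{2a+n−1}, over all integers a with 2a + n ≥ 1, satisfies
--     W_{n+2} = W_{n+1} + q^n W_n,   W_0 = χ,   W_1 = X.
-- Hence N_n W_{n+1} + q^n N_{n+1} W_n does not depend on n.  At n = 0 it is the series of the
-- theorem.  As n → ∞, N_n tends to (−q;q)_∞ and W_{n+1} to Σ_{a ∈ ℤ} q^{a²} / (−q;q)_∞, which is
-- 1 / (−q;q)_∞ because a and −a cancel; so the constant is 1.
module Submission where

open import Defs
open import Data.Bool using (Bool; true; false; not; _∧_; _∨_; _xor_)
open import Data.Bool.Properties using (xor-comm; xor-assoc; xor-same; xor-identityʳ; ∧-identityʳ; ∧-zeroʳ; ∧-comm; ∧-distribˡ-xor; ∧-distribʳ-xor; not-distribˡ-xor; not-involutive; xor-annihilates-not)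
open import Data.Bool.Solver using (module xor-∧-Solver)
open import Data.Nat using (ℕ; zero; suc; _+_; _*_; _∸_; _≤_; _<_; z≤n; s≤s; _≡ᵇ_; ∣_-_∣; _≟_; _≤?_)
open import Data.Nat.Properties
open import Data.Nat.DivMod using (_/_; _%_; [m+n]%n≡m%n; m<n⇒m%n≡m)
import Data.Nat.Divisibility as ℕ
open import Data.Nat.ListAction using (sum)
open import Data.Nat.Tactic.RingSolver using (solve-∀)
open import Data.Integer as ℤ using (ℤ; +_; -[1+_]; _⊖_)
open import Data.Integer.Properties as ℤ using ([1+m]⊖[1+n]≡m⊖n)
open import Data.Integer.Divisibility using (_∣_)
open import Data.List using (List; []; _∷_; _++_; map; length; filter)
open import Data.List.Membership.DecPropositional (_≟_) using (_∈?_)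
open import Data.Sum using (_⊎_; inj₁; inj₂)
open import Data.Empty using (⊥-elim)
open import Function using (_∘_)
open import Relation.Nullary using (does; yes; no; ¬?)
open import Relation.Unary using (Decidable)
open import Relation.Binary.PropositionalEquality

-- Power series over the field with two elements

Series₂ : Set
Series₂ = ℕ → Bool

infixr 5 _⊕_
_⊕_ : Series₂ → Series₂ → Series₂
(f ⊕ g) j = f j xor g j

1₂ : Series₂
1₂ zero    = true
1₂ (suc _) = false

infixr 7 q^_·_
q^_·_ : ℕ → Series₂ → Series₂
(q^ zero  · f) j       = f j
(q^ suc a · f) zero    = false
(q^ suc a · f) (suc j) = (q^ a · f) j

infixl 7 _✶_
-- The Cauchy product, by recursion on the degree through f = f(0) + q f′ in the left factor.
_✶_ : Series₂ → Series₂ → Series₂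
(f ✶ g) zero    = f 0 ∧ g 0
(f ✶ g) (suc j) = (f 0 ∧ g (suc j)) xor ((f ∘ suc) ✶ g) j

∑ : ℕ → (ℕ → Bool) → Bool
∑ zero    f = f 0
∑ (suc n) f = ∑ n f xor f (suc n)

xor-interchange : ∀ a b c d → (a xor b) xor (c xor d) ≡ (a xor c) xor (b xor d)
xor-interchange = solve 4 (λ a b c d → (a :+ b) :+ (c :+ d) := (a :+ c) :+ (b :+ d)) refl
  where open xor-∧-Solver

xor-cancelʳ : ∀ a c → a ≡ (a xor c) xor c
xor-cancelʳ = solve 2 (λ a c → a := (a :+ c) :+ c) refl
  where open xor-∧-Solver

-- Equality is asked only for `a + i ≤ j`: the truncated series agree only in low degrees, and the
-- induction in `nonRascoe-three-term` lives on the degree dropping by `a`.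
q^-cong : ∀ a j {f g} → (∀ i → a + i ≤ j → f i ≡ g i) → (q^ a · f) j ≡ (q^ a · g) j
q^-cong zero    j       eq = eq j ≤-refl
q^-cong (suc a) zero    eq = refl
q^-cong (suc a) (suc j) eq = q^-cong a j (λ i le → eq i (s≤s le))

q^-⊕ : ∀ a f g j → (q^ a · (f ⊕ g)) j ≡ (q^ a · f ⊕ q^ a · g) j
q^-⊕ zero    f g j       = refl
q^-⊕ (suc a) f g zero    = refl
q^-⊕ (suc a) f g (suc j) = q^-⊕ a f g j

q^-q^ : ∀ a c f j → (q^ a · q^ c · f) j ≡ (q^ a + c · f) j
q^-q^ zero    c f j       = refl
q^-q^ (suc a) c f zero    = refl
q^-q^ (suc a) c f (suc j) = q^-q^ a c f j

q^-exponent : ∀ {a c} → a ≡ c → ∀ f j → (q^ a · f) j ≡ (q^ c · f) j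
q^-exponent refl f j = refl

q^-swap : ∀ a c f j → (q^ a · q^ c · f) j ≡ (q^ c · q^ a · f) j
q^-swap a c f j = trans (q^-q^ a c f j) (trans (q^-exponent (+-comm a c) f j) (sym (q^-q^ c a f j)))

q^-low : ∀ {a j} f → j < a → (q^ a · f) j ≡ false
q^-low {j = zero}  f (s≤s _)  = refl
q^-low {j = suc j} f (s≤s lt) = q^-low f lt

q^-≡ᵇ : ∀ a w j → (q^ a · (w ≡ᵇ_)) j ≡ (a + w ≡ᵇ j)
q^-≡ᵇ zero    w j       = refl
q^-≡ᵇ (suc a) w zero    = refl
q^-≡ᵇ (suc a) w (suc j) = q^-≡ᵇ a w j

q^-∧ : ∀ a f x j → (q^ a · (λ i → f i ∧ x)) j ≡ (q^ a · f) j ∧ x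
q^-∧ zero    f x j       = refl
q^-∧ (suc a) f x zero    = refl
q^-∧ (suc a) f x (suc j) = q^-∧ a f x j

∑-cong : ∀ n {f g} → (∀ i → i ≤ n → f i ≡ g i) → ∑ n f ≡ ∑ n g
∑-cong zero    eq = eq 0 z≤n
∑-cong (suc n) eq = cong₂ _xor_ (∑-cong n (λ i le → eq i (m≤n⇒m≤1+n le))) (eq (suc n) ≤-refl)

∑-xor : ∀ n f g → ∑ n (λ i → f i xor g i) ≡ ∑ n f xor ∑ n g
∑-xor zero    f g = refl
∑-xor (suc n) f g = trans (cong (_xor (f (suc n) xor g (suc n))) (∑-xor n f g))
                          (xor-interchange (∑ n f) (∑ n g) (f (suc n)) (g (suc n)))

∑-false : ∀ n {f} → (∀ i → i ≤ n → f i ≡ false) → ∑ n f ≡ false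
∑-false zero    eq = eq 0 z≤n
∑-false (suc n) eq = cong₂ _xor_ (∑-false n (λ i le → eq i (m≤n⇒m≤1+n le))) (eq (suc n) ≤-refl)

∑-head : ∀ n f → ∑ (suc n) f ≡ f 0 xor ∑ n (f ∘ suc)
∑-head zero    f = refl
∑-head (suc n) f = trans (cong (_xor f (suc (suc n))) (∑-head n f)) (xor-assoc (f 0) _ _)

∑-extend : ∀ {m n f} → m ≤ n → (∀ i → m < i → f i ≡ false) → ∑ n f ≡ ∑ m f
∑-extend {m} {zero}  z≤n eq = refl
∑-extend {m} {suc n} le  eq with m≤n⇒m<n∨m≡n le
... | inj₂ refl    = refl
... | inj₁ (s≤s p) = trans (cong₂ _xor_ (∑-extend p eq) (eq (suc n) (s≤s p))) (xor-identityʳ _)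

≡ᵇ-refl : ∀ n → (n ≡ᵇ n) ≡ true
≡ᵇ-refl zero    = refl
≡ᵇ-refl (suc n) = ≡ᵇ-refl n

≢⇒≡ᵇ-false : ∀ {m n} → m ≢ n → (m ≡ᵇ n) ≡ false
≢⇒≡ᵇ-false {zero}  {zero}  ne = ⊥-elim (ne refl)
≢⇒≡ᵇ-false {zero}  {suc n} ne = refl
≢⇒≡ᵇ-false {suc m} {zero}  ne = refl
≢⇒≡ᵇ-false {suc m} {suc n} ne = ≢⇒≡ᵇ-false (ne ∘ cong suc)

-- If `c` is out of range no index matches, so `h c` itself has to vanish. This lets a summation
-- index name the forbidden part before its size is known.
∑-δ : ∀ n c (h : ℕ → Bool) → (n < c → h c ≡ false) → ∑ n (λ t → (c ≡ᵇ t) ∧ h t) ≡ h c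
∑-δ zero    zero    h out = refl
∑-δ zero    (suc c) h out = sym (out (s≤s z≤n))
∑-δ (suc n) c h out with c ≟ suc n
... | yes refl = cong₂ _xor_
        (∑-false n (λ i le → cong (_∧ h i) (≢⇒≡ᵇ-false (>⇒≢ (s≤s le)))))
        (cong (_∧ h (suc n)) (≡ᵇ-refl n))
... | no  ne   = trans
        (cong₂ _xor_ (∑-δ n c h (λ lt → out (≤∧≢⇒< lt (ne ∘ sym))))
                     (cong (_∧ h (suc n)) (≢⇒≡ᵇ-false ne)))
        (xor-identityʳ _)

q^-∑ : ∀ a n (F : ℕ → Series₂) j → (q^ a · (λ i → ∑ n (λ t → F t i))) j ≡ ∑ n (λ t → (q^ a · F t) j)
q^-∑ zero    n F j       = refl
q^-∑ (suc a) n F zero    = sym (∑-false n (λ _ _ → refl))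
q^-∑ (suc a) n F (suc j) = q^-∑ a n F j

✶-cong : ∀ j {f f′ g g′} → (∀ i → i ≤ j → f i ≡ f′ i) → (∀ i → i ≤ j → g i ≡ g′ i) →
         (f ✶ g) j ≡ (f′ ✶ g′) j
✶-cong zero    eq₁ eq₂ = cong₂ _∧_ (eq₁ 0 z≤n) (eq₂ 0 z≤n)
✶-cong (suc j) eq₁ eq₂ = cong₂ _xor_
  (cong₂ _∧_ (eq₁ 0 z≤n) (eq₂ (suc j) ≤-refl))
  (✶-cong j (λ i le → eq₁ (suc i) (s≤s le)) (λ i le → eq₂ i (m≤n⇒m≤1+n le)))

✶-congˡ : ∀ j {f f′} g → (∀ i → i ≤ j → f i ≡ f′ i) → (f ✶ g) j ≡ (f′ ✶ g) j
✶-congˡ j g eq = ✶-cong j {g = g} eq (λ _ _ → refl)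

✶-congʳ : ∀ j f {g g′} → (∀ i → i ≤ j → g i ≡ g′ i) → (f ✶ g) j ≡ (f ✶ g′) j
✶-congʳ j f eq = ✶-cong j {f = f} (λ _ _ → refl) eq

✶-distribʳ : ∀ f f′ g j → ((f ⊕ f′) ✶ g) j ≡ (f ✶ g ⊕ f′ ✶ g) j
✶-distribʳ f f′ g zero    = ∧-distribʳ-xor (g 0) (f 0) (f′ 0)
✶-distribʳ f f′ g (suc j) = trans
  (cong₂ _xor_ (∧-distribʳ-xor (g (suc j)) (f 0) (f′ 0)) (✶-distribʳ (f ∘ suc) (f′ ∘ suc) g j))
  (xor-interchange (f 0 ∧ g (suc j)) _ _ _)

✶-distribˡ : ∀ f g g′ j → (f ✶ (g ⊕ g′)) j ≡ (f ✶ g ⊕ f ✶ g′) j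
✶-distribˡ f g g′ zero    = ∧-distribˡ-xor (f 0) (g 0) (g′ 0)
✶-distribˡ f g g′ (suc j) = trans
  (cong₂ _xor_ (∧-distribˡ-xor (f 0) (g (suc j)) (g′ (suc j))) (✶-distribˡ (f ∘ suc) g g′ j))
  (xor-interchange (f 0 ∧ g (suc j)) _ _ _)

✶-q^ˡ : ∀ a f g j → ((q^ a · f) ✶ g) j ≡ (q^ a · (f ✶ g)) j
✶-q^ˡ zero    f g j       = refl
✶-q^ˡ (suc a) f g zero    = refl
✶-q^ˡ (suc a) f g (suc j) = ✶-q^ˡ a f g j

✶-q¹ʳ : ∀ f g j → (f ✶ (q^ 1 · g)) (suc j) ≡ (f ✶ g) j
✶-q¹ʳ f g zero    = trans (cong ((f 0 ∧ g 0) xor_) (∧-zeroʳ (f 1))) (xor-identityʳ _)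
✶-q¹ʳ f g (suc j) = cong ((f 0 ∧ g (suc j)) xor_) (✶-q¹ʳ (f ∘ suc) g j)

✶-q^ʳ : ∀ a f g j → (f ✶ (q^ a · g)) j ≡ (q^ a · (f ✶ g)) j
✶-q^ʳ zero    f g j       = refl
✶-q^ʳ (suc a) f g zero    = ∧-zeroʳ (f 0)
✶-q^ʳ (suc a) f g (suc j) = trans (✶-congʳ (suc j) f (λ i _ → sym (q^-q^ 1 a g i)))
  (trans (✶-q¹ʳ f (q^ a · g) j) (✶-q^ʳ a f g j))

✶-identityʳ : ∀ f j → (f ✶ 1₂) j ≡ f j
✶-identityʳ f zero    = ∧-identityʳ (f 0)
✶-identityʳ f (suc j) = trans (cong (_xor ((f ∘ suc) ✶ 1₂) j) (∧-zeroʳ (f 0))) (✶-identityʳ (f ∘ suc) j)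

✶-as-∑ : ∀ f g m → ∑ m (λ i → f i ∧ g (m ∸ i)) ≡ (f ✶ g) m
✶-as-∑ f g zero    = refl
✶-as-∑ f g (suc m) = trans (∑-head m (λ i → f i ∧ g (suc m ∸ i)))
  (cong ((f 0 ∧ g (suc m)) xor_) (✶-as-∑ (f ∘ suc) g m))

-- Parity sums over partitions into distinct parts

infix 7 _∈ᵇ_
_∈ᵇ_ : ℕ → List ℕ → Bool
t ∈ᵇ p = does (t ∈? p)

-- Runs over the same lists as subsetsUpTo M.
⨁ : ℕ → (List ℕ → Bool) → Bool
⨁ zero    f = f []
⨁ (suc M) f = ⨁ M f xor ⨁ M (f ∘ (suc M ∷_))

PartsIn : ℕ → List ℕ → Set
PartsIn M p = ∀ t → t ≡ 0 ⊎ M < t → t ∈ᵇ p ≡ false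

PartsIn-suc : ∀ {M p} → PartsIn M p → PartsIn (suc M) p
PartsIn-suc out t (inj₁ eq) = out t (inj₁ eq)
PartsIn-suc out t (inj₂ lt) = out t (inj₂ (<⇒≤ lt))

PartsIn-∷ : ∀ {M p} → PartsIn M p → PartsIn (suc M) (suc M ∷ p)
PartsIn-∷ out t (inj₁ refl) = out 0 (inj₁ refl)
PartsIn-∷ out t (inj₂ lt)   = cong₂ _∨_ (≢⇒≡ᵇ-false (>⇒≢ lt)) (out t (inj₂ (<⇒≤ lt)))

⨁-cong : ∀ M {f g} → (∀ p → PartsIn M p → f p ≡ g p) → ⨁ M f ≡ ⨁ M g
⨁-cong zero    eq = eq [] (λ _ _ → refl)
⨁-cong (suc M) eq = cong₂ _xor_ (⨁-cong M (λ p out → eq p (PartsIn-suc {p = p} out)))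
                                (⨁-cong M (λ p out → eq (suc M ∷ p) (PartsIn-∷ {p = p} out)))

⨁-xor : ∀ M f g → ⨁ M (λ p → f p xor g p) ≡ ⨁ M f xor ⨁ M g
⨁-xor zero    f g = refl
⨁-xor (suc M) f g = trans (cong₂ _xor_ (⨁-xor M f g) (⨁-xor M (f ∘ (suc M ∷_)) (g ∘ (suc M ∷_))))
                          (xor-interchange (⨁ M f) _ _ _)

⨁-false : ∀ M {f} → (∀ p → PartsIn M p → f p ≡ false) → ⨁ M f ≡ false
⨁-false M eq = trans (⨁-cong M eq) (zeros M)
  where
  zeros : ∀ M → ⨁ M (λ _ → false) ≡ false
  zeros zero    = refl
  zeros (suc M) = cong₂ _xor_ (zeros M) (zeros M)

⨁-∑ : ∀ M n (F : ℕ → List ℕ → Bool) → ⨁ M (λ p → ∑ n (λ t → F t p)) ≡ ∑ n (λ t → ⨁ M (F t))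
⨁-∑ zero    n F = refl
⨁-∑ (suc M) n F = trans (cong₂ _xor_ (⨁-∑ M n F) (⨁-∑ M n (λ t p → F t (suc M ∷ p))))
                        (sym (∑-xor n _ _))

q^-⨁ : ∀ a M (F : List ℕ → Series₂) j → (q^ a · (λ i → ⨁ M (λ p → F p i))) j ≡ ⨁ M (λ p → (q^ a · F p) j)
q^-⨁ zero    M F j       = refl
q^-⨁ (suc a) M F zero    = sym (⨁-false M (λ _ _ → refl))
q^-⨁ (suc a) M F (suc j) = q^-⨁ a M F j

-- A list with a part above `j` has sum above `j`, so allowing larger parts adds only zeros.
⨁-extend : ∀ {j M f} → j ≤ M → (∀ p → j < sum p → f p ≡ false) → ⨁ M f ≡ ⨁ j f
⨁-extend {j} {zero}  z≤n big = refl
⨁-extend {j} {suc M} le  big with m≤n⇒m<n∨m≡n le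
... | inj₂ refl    = refl
... | inj₁ (s≤s l) = trans
        (cong₂ _xor_ (⨁-extend l big)
                     (⨁-false M (λ p _ → big (suc M ∷ p) (≤-trans (s≤s l) (m≤m+n (suc M) (sum p))))))
        (xor-identityʳ _)

-- Deleting `t` is a bijection from the partitions with part `t` to those without it. The function
-- `g` is arbitrary so that the induction can absorb a part larger than `t` into it.
⨁-remove : ∀ M t (g : ℕ → ℕ → Bool) → 0 < t → t ≤ M →
  ⨁ M (λ p → t ∈ᵇ p ∧ g (length p) (sum p)) ≡
  ⨁ M (λ p → not (t ∈ᵇ p) ∧ g (suc (length p)) (t + sum p))
⨁-remove zero    t g (s≤s _) ()
⨁-remove (suc M) t g 0<t le with m≤n⇒m<n∨m≡n le
... | inj₁ (s≤s l) = cong₂ _xor_ (⨁-remove M t g 0<t l) (begin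
  ⨁ M (λ p → t ∈ᵇ (suc M ∷ p) ∧ g (suc (length p)) (suc M + sum p))
    ≡⟨ ⨁-cong M (λ p _ → cong (λ x → (x ∨ t ∈ᵇ p) ∧ g (suc (length p)) (suc M + sum p)) new) ⟩
  ⨁ M (λ p → t ∈ᵇ p ∧ g (suc (length p)) (suc M + sum p))
    ≡⟨ ⨁-remove M t (λ n s → g (suc n) (suc M + s)) 0<t l ⟩
  ⨁ M (λ p → not (t ∈ᵇ p) ∧ g (suc (suc (length p))) (suc M + (t + sum p)))
    ≡⟨ ⨁-cong M (λ p _ → cong₂ _∧_ (cong (λ x → not (x ∨ t ∈ᵇ p)) (sym new))
         (cong (g (suc (suc (length p)))) (+-swap (suc M) t (sum p)))) ⟩
  ⨁ M (λ p → not (t ∈ᵇ (suc M ∷ p)) ∧ g (suc (suc (length p))) (t + (suc M + sum p))) ∎)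
  where
  open ≡-Reasoning
  new : (t ≡ᵇ suc M) ≡ false
  new = ≢⇒≡ᵇ-false (<⇒≢ (s≤s l))
  +-swap : ∀ a b c → a + (b + c) ≡ b + (a + c)
  +-swap = solve-∀
-- Here `t` is the largest admissible part: it lies in every list of the second half and in none of
-- the first, so one half vanishes on each side.
... | inj₂ refl = begin
  ⨁ M (λ p → t ∈ᵇ p ∧ g (length p) (sum p)) xor
  ⨁ M (λ p → t ∈ᵇ (t ∷ p) ∧ g (suc (length p)) (t + sum p))
    ≡⟨ cong₂ _xor_
         (⨁-false M (λ p out → cong (_∧ g (length p) (sum p)) (out t (inj₂ ≤-refl))))
         (⨁-cong M (λ p _ → cong (λ x → (x ∨ t ∈ᵇ p) ∧ g (suc (length p)) (t + sum p)) (≡ᵇ-refl t))) ⟩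
  ⨁ M (λ p → g (suc (length p)) (t + sum p))
    ≡⟨ xor-identityʳ _ ⟨
  ⨁ M (λ p → g (suc (length p)) (t + sum p)) xor false
    ≡⟨ cong₂ _xor_
         (⨁-cong M (λ p out → cong (λ x → not x ∧ g (suc (length p)) (t + sum p)) (out t (inj₂ ≤-refl))))
         (⨁-false M (λ p _ → cong (λ x → not (x ∨ t ∈ᵇ p) ∧ g (suc (suc (length p))) (t + (t + sum p))) (≡ᵇ-refl t))) ⟨
  ⨁ M (λ p → not (t ∈ᵇ p) ∧ g (suc (length p)) (t + sum p)) xor
  ⨁ M (λ p → not (t ∈ᵇ (t ∷ p)) ∧ g (suc (suc (length p))) (t + (t + sum p))) ∎
  where open ≡-Reasoning

-- Generating functions of non-Rascoe partitions

-- The size of the partition after every part is raised by `k`.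
weight : ℕ → List ℕ → ℕ
weight k p = k * length p + sum p

-- ∏_{i=1}^{M} (1 + q^{i+k}); M only truncates, degrees up to M are those of the infinite product.
distinctSeries : ℕ → ℕ → Series₂
distinctSeries M k j = ⨁ M (λ p → weight k p ≡ᵇ j)

-- With k = 0 these are the generalized non-Rascoe partitions associated with ℓ (parts ≤ M).
nonRascoe : ℕ → ℕ → ℕ → Series₂
nonRascoe M ℓ k j = ⨁ M (λ p → (weight k p ≡ᵇ j) ∧ not ((ℓ + length p) ∈ᵇ p))

weight-∷ : ∀ k x p → weight k (x ∷ p) ≡ (x + k) + weight k p
weight-∷ k x p = ring k x (length p) (sum p)
  where
  ring : ∀ k x n s → k * suc n + (x + s) ≡ (x + k) + (k * n + s)
  ring = solve-∀

distinctSeries-zero : ∀ k j → distinctSeries 0 k j ≡ 1₂ j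
distinctSeries-zero k j = trans (cong (λ w → w + 0 ≡ᵇ j) (*-zeroʳ k)) (lemma j)
  where
  lemma : ∀ j → (0 ≡ᵇ j) ≡ 1₂ j
  lemma zero    = refl
  lemma (suc j) = refl

distinctSeries-suc : ∀ M k j →
  distinctSeries (suc M) k j ≡ (distinctSeries M k ⊕ q^ suc M + k · distinctSeries M k) j
distinctSeries-suc M k j = cong (distinctSeries M k j xor_) (sym (trans
  (q^-⨁ (suc M + k) M (λ p → weight k p ≡ᵇ_) j)
  (⨁-cong M (λ p _ → trans (q^-≡ᵇ (suc M + k) (weight k p) j)
                            (cong (_≡ᵇ j) (sym (weight-∷ k (suc M) p)))))))

-- Takes off the factor with the smallest exponent, where `distinctSeries-suc` takes off the one
-- with the largest; the induction commutes the two.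
distinctSeries-peel : ∀ M k j →
  distinctSeries (suc M) k j ≡ (distinctSeries M (suc k) ⊕ q^ suc k · distinctSeries M (suc k)) j
distinctSeries-peel zero k j = begin
  distinctSeries 1 k j
    ≡⟨ distinctSeries-suc 0 k j ⟩
  distinctSeries 0 k j xor (q^ suc k · distinctSeries 0 k) j
    ≡⟨ cong₂ _xor_ (const j) (q^-cong (suc k) j (λ i _ → const i)) ⟩
  distinctSeries 0 (suc k) j xor (q^ suc k · distinctSeries 0 (suc k)) j ∎
  where
  open ≡-Reasoning
  const : ∀ i → distinctSeries 0 k i ≡ distinctSeries 0 (suc k) i
  const i = trans (distinctSeries-zero k i) (sym (distinctSeries-zero (suc k) i))
distinctSeries-peel (suc M) k j = begin
  D (suc (suc M)) k j
    ≡⟨ distinctSeries-suc (suc M) k j ⟩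
  D (suc M) k j xor (q^ c · D (suc M) k) j
    ≡⟨ cong₂ _xor_ (distinctSeries-peel M k j)
         (trans (q^-cong c j (λ i _ → distinctSeries-peel M k i)) (q^-⊕ c A (q^ suc k · A) j)) ⟩
  (A j xor (q^ suc k · A) j) xor ((q^ c · A) j xor (q^ c · q^ suc k · A) j)
    ≡⟨ xor-interchange (A j) _ _ _ ⟩
  (A j xor (q^ c · A) j) xor ((q^ suc k · A) j xor (q^ c · q^ suc k · A) j)
    ≡⟨ cong (λ x → (A j xor (q^ c · A) j) xor ((q^ suc k · A) j xor x)) (q^-swap c (suc k) A j) ⟩
  (A j xor (q^ c · A) j) xor ((q^ suc k · A) j xor (q^ suc k · q^ c · A) j)
    ≡⟨ cong ((A j xor (q^ c · A) j) xor_) (q^-⊕ (suc k) A (q^ c · A) j) ⟨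
  (A ⊕ q^ c · A) j xor (q^ suc k · (A ⊕ q^ c · A)) j
    ≡⟨ cong₂ _xor_ (step j) (q^-cong (suc k) j (λ i _ → step i)) ⟩
  D (suc M) (suc k) j xor (q^ suc k · D (suc M) (suc k)) j ∎
  where
  open ≡-Reasoning
  D = distinctSeries
  A = D M (suc k)
  c = suc (suc M) + k
  step : ∀ i → (A ⊕ q^ c · A) i ≡ D (suc M) (suc k) i
  step i = trans (cong (A i xor_) (q^-exponent (sym (+-suc (suc M) k)) A i))
                 (sym (distinctSeries-suc M (suc k) i))

-- The factor that separates this from `distinctSeries-peel` is 1 + q^e with e above the truncation
-- degree.
distinctSeries-shift : ∀ M k j → j ≤ M →
  distinctSeries M k j ≡ (distinctSeries M (suc k) ⊕ q^ suc k · distinctSeries M (suc k)) j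
distinctSeries-shift zero    k zero z≤n = trans (distinctSeries-zero k 0)
  (sym (trans (xor-identityʳ _) (distinctSeries-zero (suc k) 0)))
distinctSeries-shift (suc M) k j le = trans (distinctSeries-peel M k j)
  (cong₂ _xor_ (stable j le) (q^-cong (suc k) j (λ i l → stable i (≤-trans (m≤n+m i (suc k)) (≤-trans l le)))))
  where
  stable : ∀ i → i ≤ suc M → distinctSeries M (suc k) i ≡ distinctSeries (suc M) (suc k) i
  stable i l = sym (trans (distinctSeries-suc M (suc k) i)
    (trans (cong (distinctSeries M (suc k) i xor_)
             (q^-low (distinctSeries M (suc k)) (<-≤-trans (s≤s l) (s≤s (subst (suc M ≤_) (sym (+-suc M k)) (s≤s (m≤m+n M k)))))))
           (xor-identityʳ _)))

-- Deleting the forbidden part ℓ + #p from a partition p leaves one with #p − 1 parts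
-- that lacks (ℓ + 1) + (#p − 1); its weight moves from k to k + 1.
nonRascoe-remove : ∀ M ℓ k j → j ≤ M →
  distinctSeries M k j ≡ (nonRascoe M ℓ k ⊕ q^ suc (ℓ + k) · nonRascoe M (suc ℓ) (suc k)) j
nonRascoe-remove M ℓ k j j≤M = begin
  distinctSeries M k j
    ≡⟨ ⨁-cong M (λ p _ → split (weight k p ≡ᵇ j) ((ℓ + length p) ∈ᵇ p)) ⟩
  ⨁ M (λ p → ((weight k p ≡ᵇ j) ∧ not ((ℓ + length p) ∈ᵇ p)) xor ((ℓ + length p) ∈ᵇ p ∧ (weight k p ≡ᵇ j)))
    ≡⟨ ⨁-xor M _ _ ⟩
  nonRascoe M ℓ k j xor ⨁ M (λ p → (ℓ + length p) ∈ᵇ p ∧ (weight k p ≡ᵇ j))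
    ≡⟨ cong (nonRascoe M ℓ k j xor_) bijection ⟩
  nonRascoe M ℓ k j xor (q^ suc (ℓ + k) · nonRascoe M (suc ℓ) (suc k)) j ∎
  where
  open ≡-Reasoning

  split : ∀ x y → x ≡ (x ∧ not y) xor (y ∧ x)
  split false false = refl
  split false true  = refl
  split true  false = refl
  split true  true  = refl

  ∧-swap : ∀ x y z → x ∧ (y ∧ z) ≡ y ∧ (x ∧ z)
  ∧-swap = solve 3 (λ x y z → x :* (y :* z) := y :* (x :* z)) refl
    where open xor-∧-Solver

  -- The forbidden part depends on the partition, while `⨁-remove` treats a fixed part; the sum is
  -- therefore split by the value `t` of the forbidden part.
  selected : ℕ → ℕ → ℕ → Bool
  selected t n s = (ℓ + n ≡ᵇ t) ∧ (k * n + s ≡ᵇ j)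

  remove : ∀ t → t ≤ M →
    ⨁ M (λ p → t ∈ᵇ p ∧ selected t (length p) (sum p)) ≡
    ⨁ M (λ p → not (t ∈ᵇ p) ∧ selected t (suc (length p)) (t + sum p))
  remove zero    le = trans
    (⨁-false M (λ p out → cong (_∧ selected 0 (length p) (sum p)) (out 0 (inj₁ refl))))
    (sym (⨁-false M (λ p _ → trans
      (cong (λ x → not (0 ∈ᵇ p) ∧ ((x ≡ᵇ 0) ∧ (k * suc (length p) + sum p ≡ᵇ j))) (+-suc ℓ (length p)))
      (∧-zeroʳ _))))
  remove (suc t) le = ⨁-remove M (suc t) (selected (suc t)) (s≤s z≤n) le

  -- The deleted part has weight ℓ + n + 1 + k. Handing one unit to each of the n remaining parts
  -- turns `k` into `suc k` and leaves ℓ + k + 1.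
  total : ∀ n s → k * suc n + ((ℓ + suc n) + s) ≡ suc (ℓ + k) + (suc k * n + s)
  total = ring ℓ k
    where
    ring : ∀ ℓ k n s → k * suc n + ((ℓ + suc n) + s) ≡ suc (ℓ + k) + (suc k * n + s)
    ring = solve-∀

  bijection : ⨁ M (λ p → (ℓ + length p) ∈ᵇ p ∧ (weight k p ≡ᵇ j)) ≡
              (q^ suc (ℓ + k) · nonRascoe M (suc ℓ) (suc k)) j
  bijection = begin
    ⨁ M (λ p → (ℓ + length p) ∈ᵇ p ∧ (weight k p ≡ᵇ j))
      ≡⟨ ⨁-cong M (λ p out → sym (trans
           (∑-cong M (λ t _ → ∧-swap (t ∈ᵇ p) (ℓ + length p ≡ᵇ t) (weight k p ≡ᵇ j)))
           (∑-δ M (ℓ + length p) (λ t → t ∈ᵇ p ∧ (weight k p ≡ᵇ j))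
             (λ lt → cong (_∧ (weight k p ≡ᵇ j)) (out _ (inj₂ lt)))))) ⟩
    ⨁ M (λ p → ∑ M (λ t → t ∈ᵇ p ∧ selected t (length p) (sum p)))
      ≡⟨ ⨁-∑ M M _ ⟩
    ∑ M (λ t → ⨁ M (λ p → t ∈ᵇ p ∧ selected t (length p) (sum p)))
      ≡⟨ ∑-cong M remove ⟩
    ∑ M (λ t → ⨁ M (λ p → not (t ∈ᵇ p) ∧ selected t (suc (length p)) (t + sum p)))
      ≡⟨ ⨁-∑ M M _ ⟨
    ⨁ M (λ p → ∑ M (λ t → not (t ∈ᵇ p) ∧ selected t (suc (length p)) (t + sum p)))
      ≡⟨ ⨁-cong M (λ p out → trans
           (∑-cong M (λ t _ → ∧-swap (not (t ∈ᵇ p)) (ℓ + suc (length p) ≡ᵇ t) (k * suc (length p) + (t + sum p) ≡ᵇ j)))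
           (∑-δ M (ℓ + suc (length p)) (λ t → not (t ∈ᵇ p) ∧ (k * suc (length p) + (t + sum p) ≡ᵇ j))
             -- A deleted part above `M` would push the weight above `j`; this is where `j ≤ M`
             -- enters.
             (λ lt → trans (cong (not ((ℓ + suc (length p)) ∈ᵇ p) ∧_) (≢⇒≡ᵇ-false (>⇒≢ (≤-<-trans j≤M (<-≤-trans lt
                (≤-trans (m≤m+n _ (sum p)) (m≤n+m _ (k * suc (length p)))))))))
                (∧-zeroʳ (not ((ℓ + suc (length p)) ∈ᵇ p)))))) ⟩
    ⨁ M (λ p → not ((ℓ + suc (length p)) ∈ᵇ p) ∧ (k * suc (length p) + ((ℓ + suc (length p)) + sum p) ≡ᵇ j))
      ≡⟨ ⨁-cong M (λ p _ → trans (∧-comm (not ((ℓ + suc (length p)) ∈ᵇ p)) _) (cong₂ _∧_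
           (trans (cong (_≡ᵇ j) (total (length p) (sum p))) (sym (q^-≡ᵇ (suc (ℓ + k)) (weight (suc k) p) j)))
           (cong (λ x → not (x ∈ᵇ p)) (+-suc ℓ (length p))))) ⟩
    ⨁ M (λ p → (q^ suc (ℓ + k) · (weight (suc k) p ≡ᵇ_)) j ∧ not ((suc ℓ + length p) ∈ᵇ p))
      ≡⟨ ⨁-cong M (λ p _ → q^-∧ (suc (ℓ + k)) (weight (suc k) p ≡ᵇ_) _ j) ⟨
    ⨁ M (λ p → (q^ suc (ℓ + k) · (λ i → (weight (suc k) p ≡ᵇ i) ∧ not ((suc ℓ + length p) ∈ᵇ p))) j)
      ≡⟨ q^-⨁ (suc (ℓ + k)) M _ j ⟨
    (q^ suc (ℓ + k) · nonRascoe M (suc ℓ) (suc k)) j ∎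

nonRascoe-step : ∀ M ℓ k j → j ≤ M →
  nonRascoe M ℓ k j ≡ (distinctSeries M k ⊕ q^ suc (ℓ + k) · nonRascoe M (suc ℓ) (suc k)) j
nonRascoe-step M ℓ k j le = trans (xor-cancelʳ (nonRascoe M ℓ k j) _)
  (cong (_xor (q^ suc (ℓ + k) · nonRascoe M (suc ℓ) (suc k)) j) (sym (nonRascoe-remove M ℓ k j le)))

-- Only k = 0 is wanted, but nonRascoe-remove raises k, so the induction on the degree needs all k.
nonRascoe-three-term : ∀ M ℓ k j → j ≤ M →
  (nonRascoe M ℓ k ⊕ q^ k · nonRascoe M (suc ℓ) k ⊕ q^ suc (ℓ + k) · nonRascoe M (2 + ℓ) k) j ≡
  (distinctSeries M k ⊕ q^ k · distinctSeries M k) j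
nonRascoe-three-term M ℓ k j = go (suc j) ℓ k j ≤-refl
  where
  go : ∀ n ℓ k j → j < n → j ≤ M →
    (nonRascoe M ℓ k ⊕ q^ k · nonRascoe M (suc ℓ) k ⊕ q^ suc (ℓ + k) · nonRascoe M (2 + ℓ) k) j ≡
    (distinctSeries M k ⊕ q^ k · distinctSeries M k) j
  go (suc n) ℓ k j (s≤s j≤n) j≤M = begin
    nonRascoe M ℓ k j xor (q^ k · nonRascoe M (suc ℓ) k) j xor (q^ s · nonRascoe M (2 + ℓ) k) j
      ≡⟨ cong₂ _xor_ (nonRascoe-step M ℓ k j j≤M) (cong₂ _xor_ term₂ term₃) ⟩
    (E j xor (q^ s · N₁) j) xor ((q^ k · E) j xor (q^ s · q^ suc k · N₂) j) xor ((q^ s · E) j xor (q^ s · N₃) j)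
      ≡⟨ regroup (E j) _ ((q^ k · E) j) _ ((q^ s · E) j) _ ⟩
    (E j xor (q^ k · E) j) xor ((q^ s · E) j xor ((q^ s · N₁) j xor (q^ s · q^ suc k · N₂) j xor (q^ s · N₃) j))
      ≡⟨ cong (λ x → (E j xor (q^ k · E) j) xor ((q^ s · E) j xor x)) inner ⟩
    (E j xor (q^ k · E) j) xor ((q^ s · E) j xor (q^ s · E) j)
      ≡⟨ cong ((E j xor (q^ k · E) j) xor_) (xor-same ((q^ s · E) j)) ⟩
    (E j xor (q^ k · E) j) xor false
      ≡⟨ xor-identityʳ _ ⟩
    E j xor (q^ k · E) j ∎
    where
    open ≡-Reasoning
    s = suc (ℓ + k)
    E = distinctSeries M k
    N₁ = nonRascoe M (1 + ℓ) (suc k)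
    N₂ = nonRascoe M (2 + ℓ) (suc k)
    N₃ = q^ suc (suc ℓ + suc k) · nonRascoe M (3 + ℓ) (suc k)

    below : ∀ {a i} → a + i ≤ j → i ≤ M
    below {a} {i} le = ≤-trans (m≤n+m i a) (≤-trans le j≤M)

    exponents : ∀ ℓ k → k + suc (suc ℓ + k) ≡ suc (ℓ + k) + suc k
    exponents = solve-∀

    term₂ : (q^ k · nonRascoe M (suc ℓ) k) j ≡ (q^ k · E) j xor (q^ s · q^ suc k · N₂) j
    term₂ = trans (q^-cong k j (λ i le → nonRascoe-step M (suc ℓ) k i (below {k} le)))
      (trans (q^-⊕ k E _ j) (cong ((q^ k · E) j xor_)
        (trans (q^-q^ k (suc (suc ℓ + k)) N₂ j)
          (trans (q^-exponent (exponents ℓ k) N₂ j) (sym (q^-q^ s (suc k) N₂ j))))))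

    term₃ : (q^ s · nonRascoe M (2 + ℓ) k) j ≡ (q^ s · E) j xor (q^ s · N₃) j
    term₃ = trans (q^-cong s j (λ i le → trans (nonRascoe-step M (2 + ℓ) k i (below {s} le))
        (cong (E i xor_) (q^-exponent (cong suc (sym (+-suc (suc ℓ) k))) (nonRascoe M (3 + ℓ) (suc k)) i))))
      (q^-⊕ s E N₃ j)

    -- The bracket is the same identity at `suc ℓ`, `suc k`, in a degree lowered by `s ≥ 1`. Its
    -- right-hand side is `E` by `distinctSeries-shift`, and the resulting `q^ s · E` cancels the
    -- one from `term₃`.
    inner : (q^ s · N₁) j xor (q^ s · q^ suc k · N₂) j xor (q^ s · N₃) j ≡ (q^ s · E) j
    inner = trans (sym (trans (q^-⊕ s N₁ (q^ suc k · N₂ ⊕ N₃) j)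
                              (cong ((q^ s · N₁) j xor_) (q^-⊕ s (q^ suc k · N₂) N₃ j))))
      (q^-cong s j (λ i le → trans
        (go n (suc ℓ) (suc k) i (≤-trans (s≤s (m≤n+m i (ℓ + k))) (≤-trans le j≤n)) (below {s} le))
        (sym (distinctSeries-shift M k i (below {s} le)))))

    regroup : ∀ a b c d e f → (a xor b) xor (c xor d) xor (e xor f) ≡ (a xor c) xor (e xor (b xor d xor f))
    regroup = solve 6 (λ a b c d e f → (a :+ b) :+ ((c :+ d) :+ (e :+ f)) := (a :+ c) :+ (e :+ (b :+ (d :+ f)))) refl
      where open xor-∧-Solver

-- At k = 0 the right-hand side of the three-term identity is a series added to itself.
nonRascoe-recurrence : ∀ M ℓ j → j ≤ M →
  nonRascoe M ℓ 0 j ≡ (nonRascoe M (suc ℓ) 0 ⊕ q^ suc ℓ · nonRascoe M (2 + ℓ) 0) j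
nonRascoe-recurrence M ℓ j le = trans (cancel (nonRascoe M ℓ 0 j) _
    (trans (nonRascoe-three-term M ℓ 0 j le) (xor-same (distinctSeries M 0 j))))
  (cong (nonRascoe M (suc ℓ) 0 j xor_) (q^-exponent (cong suc (+-identityʳ ℓ)) (nonRascoe M (2 + ℓ) 0) j))
  where
  cancel : ∀ x y → x xor y ≡ false → x ≡ y
  cancel false y     eq = sym eq
  cancel true  true  eq = refl

-- Adjoint recurrences and their invariant

forward : Series₂ → Series₂ → ℕ → Series₂
forward u v zero          = u
forward u v (suc zero)    = v
forward u v (suc (suc n)) = forward u v (suc n) ⊕ q^ n · forward u v n

casoratian : (ℕ → Series₂) → (ℕ → Series₂) → ℕ → Series₂
casoratian f w n = (f n ✶ w (suc n)) ⊕ q^ n · (f (suc n) ✶ w n)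

-- Expanding `f n` by its recurrence frees a term f(n+1) w(n+1), which joins q^n f(n+1) w(n) to give
-- f(n+1) w(n+2). The recurrence of `f` is assumed only up to degree `j`, as truncated series
-- satisfy no more.
casoratian-constant : ∀ f u v j → (∀ n i → i ≤ j → f n i ≡ (f (suc n) ⊕ q^ suc n · f (2 + n)) i) →
  ∀ n → casoratian f (forward u v) 0 j ≡ casoratian f (forward u v) n j
casoratian-constant f u v j rec zero    = refl
casoratian-constant f u v j rec (suc n) = trans (casoratian-constant f u v j rec n) (begin
  (f₀ ✶ w₁) j xor (q^ n · (f₁ ✶ w₀)) j
    ≡⟨ cong (_xor (q^ n · (f₁ ✶ w₀)) j) (trans (✶-congˡ j w₁ (rec n)) (✶-distribʳ f₁ (q^ suc n · f₂) w₁ j)) ⟩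
  ((f₁ ✶ w₁) j xor ((q^ suc n · f₂) ✶ w₁) j) xor (q^ n · (f₁ ✶ w₀)) j
    ≡⟨ swapʳ ((f₁ ✶ w₁) j) _ _ ⟩
  ((f₁ ✶ w₁) j xor (q^ n · (f₁ ✶ w₀)) j) xor ((q^ suc n · f₂) ✶ w₁) j
    ≡⟨ cong₂ _xor_
         (trans (✶-distribˡ f₁ w₁ (q^ n · w₀) j) (cong ((f₁ ✶ w₁) j xor_) (✶-q^ʳ n f₁ w₀ j)))
         (sym (✶-q^ˡ (suc n) f₂ w₁ j)) ⟨
  (f₁ ✶ forward u v (2 + n)) j xor (q^ suc n · (f₂ ✶ w₁)) j ∎)
  where
  open ≡-Reasoning
  f₀ = f n
  f₁ = f (suc n)
  f₂ = f (2 + n)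
  w₀ = forward u v n
  w₁ = forward u v (suc n)
  swapʳ : ∀ a b c → (a xor b) xor c ≡ (a xor c) xor b
  swapʳ = solve 3 (λ a b c → (a :+ b) :+ c := (a :+ c) :+ b) refl
    where open xor-∧-Solver

-- Reduction of integers and integer series modulo 2

oddℕ : ℕ → Bool
oddℕ zero    = false
oddℕ (suc n) = not (oddℕ n)

odd : ℤ → Bool
odd z = oddℕ ℤ.∣ z ∣

oddℕ-+ : ∀ m n → oddℕ (m + n) ≡ oddℕ m xor oddℕ n
oddℕ-+ zero    n = refl
oddℕ-+ (suc m) n = trans (cong not (oddℕ-+ m n)) (not-distribˡ-xor (oddℕ m) (oddℕ n))

oddℕ-* : ∀ m n → oddℕ (m * n) ≡ oddℕ m ∧ oddℕ n
oddℕ-* zero    n = refl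
oddℕ-* (suc m) n = trans (oddℕ-+ n (m * n)) (trans (cong (oddℕ n xor_) (oddℕ-* m n)) (not-∧ (oddℕ m) (oddℕ n)))
  where
  not-∧ : ∀ x y → y xor (x ∧ y) ≡ not x ∧ y
  not-∧ false y = xor-identityʳ y
  not-∧ true  y = xor-same y

odd-⊖ : ∀ m n → odd (m ⊖ n) ≡ oddℕ m xor oddℕ n
odd-⊖ zero    zero    = refl
odd-⊖ zero    (suc n) = refl
odd-⊖ (suc m) zero    = sym (xor-identityʳ _)
odd-⊖ (suc m) (suc n) = trans (cong odd ([1+m]⊖[1+n]≡m⊖n m n))
  (trans (odd-⊖ m n) (sym (xor-annihilates-not (oddℕ m) (oddℕ n))))

odd-+ : ∀ x y → odd (x ℤ.+ y) ≡ odd x xor odd y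
odd-+ (+ m)    (+ n)    = oddℕ-+ m n
odd-+ (+ m)    -[1+ n ] = odd-⊖ m (suc n)
odd-+ -[1+ m ] (+ n)    = trans (odd-⊖ n (suc m)) (xor-comm (oddℕ n) (oddℕ (suc m)))
odd-+ -[1+ m ] -[1+ n ] = trans (cong (not ∘ not) (oddℕ-+ m n))
  (trans (not-involutive _) (sym (xor-annihilates-not (oddℕ m) (oddℕ n))))

odd-* : ∀ x y → odd (x ℤ.* y) ≡ odd x ∧ odd y
odd-* x y = trans (cong oddℕ (ℤ.abs-* x y)) (oddℕ-* ℤ.∣ x ∣ ℤ.∣ y ∣)

odd-sgn : ∀ n → odd (sgn n) ≡ true
odd-sgn zero    = refl
odd-sgn (suc n) = trans (cong oddℕ (ℤ.∣-i∣≡∣i∣ (sgn n))) (odd-sgn n)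

even⇒2∣ : ∀ z → odd z ≡ false → + 2 ∣ z
even⇒2∣ z = halve ℤ.∣ z ∣
  where
  halve : ∀ n → oddℕ n ≡ false → 2 ℕ.∣ n
  halve zero          eq = ℕ.divides 0 refl
  halve (suc (suc n)) eq with halve n (trans (sym (not-involutive (oddℕ n))) eq)
  ... | ℕ.divides d refl = ℕ.divides (suc d) refl

odd-sumTo : ∀ m f → odd (sumTo m f) ≡ ∑ m (odd ∘ f)
odd-sumTo zero    f = refl
odd-sumTo (suc m) f = trans (odd-+ (sumTo m f) (f (suc m))) (cong (_xor odd (f (suc m))) (odd-sumTo m f))

odd-⋆ : ∀ f g j → odd ((f ⋆ g) j) ≡ ((odd ∘ f) ✶ (odd ∘ g)) j
odd-⋆ f g j = trans (odd-sumTo j _)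
  (trans (∑-cong j (λ i _ → odd-* (f i) (g (j ∸ i)))) (✶-as-∑ (odd ∘ f) (odd ∘ g) j))

q^-high : ∀ a f j → (q^ a · f) (a + j) ≡ f j
q^-high zero    f j = refl
q^-high (suc a) f j = q^-high a f j

odd-shift : ∀ a f j → odd (shift a f j) ≡ (q^ a · (odd ∘ f)) j
odd-shift a f j with a ≤? j
... | yes a≤j = trans (sym (q^-high a (odd ∘ f) (j ∸ a))) (cong (q^ a · (odd ∘ f)) (m+[n∸m]≡n a≤j))
... | no  a≰j = sym (q^-low (odd ∘ f) (≰⇒> a≰j))

-- The reciprocals of (-q;q)_m modulo 2

geometric : ℕ → Series₂
geometric k j = odd (invOnePlusQPow k j)

geometric-coefficient : ∀ k j → geometric k j ≡ (j % suc k ≡ᵇ 0)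
geometric-coefficient k j with j % suc k ≟ 0
... | yes eq = trans (odd-sgn (j / suc k)) (cong (_≡ᵇ 0) (sym eq))
... | no  ne = sym (≢⇒≡ᵇ-false ne)

-- Below degree k + 1 only the constant term is present; from there on the coefficients are periodic
-- with period k + 1, so the two summands cancel.
geometric-inverse : ∀ k j → (geometric k ⊕ q^ suc k · geometric k) j ≡ 1₂ j
geometric-inverse k j with suc k ≤? j
... | no  k≮j = begin
  geometric k j xor (q^ suc k · geometric k) j
    ≡⟨ cong₂ _xor_ (geometric-coefficient k j) (q^-low (geometric k) (≰⇒> k≮j)) ⟩
  (j % suc k ≡ᵇ 0) xor false
    ≡⟨ xor-identityʳ _ ⟩
  (j % suc k ≡ᵇ 0)
    ≡⟨ cong (_≡ᵇ 0) (m<n⇒m%n≡m (≰⇒> k≮j)) ⟩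
  (j ≡ᵇ 0)
    ≡⟨ constant j ⟩
  1₂ j ∎
  where
  open ≡-Reasoning
  constant : ∀ j → (j ≡ᵇ 0) ≡ 1₂ j
  constant zero    = refl
  constant (suc j) = refl
... | yes k<j = subst (λ j → (geometric k ⊕ q^ suc k · geometric k) j ≡ 1₂ j) (m+[n∸m]≡n k<j) (begin
  geometric k (suc k + i) xor (q^ suc k · geometric k) (suc k + i)
    ≡⟨ cong₂ _xor_ (geometric-coefficient k (suc k + i))
                   (trans (q^-high (suc k) (geometric k) i) (geometric-coefficient k i)) ⟩
  ((suc k + i) % suc k ≡ᵇ 0) xor (i % suc k ≡ᵇ 0)
    ≡⟨ cong (λ r → (r ≡ᵇ 0) xor (i % suc k ≡ᵇ 0))
         (trans (cong (_% suc k) (+-comm (suc k) i)) ([m+n]%n≡m%n i (suc k))) ⟩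
  (i % suc k ≡ᵇ 0) xor (i % suc k ≡ᵇ 0)
    ≡⟨ xor-same (i % suc k ≡ᵇ 0) ⟩
  false ∎)
  where
  open ≡-Reasoning
  i = j ∸ suc k

invPoch₂ : ℕ → Series₂
invPoch₂ m j = odd (invPoch m j)

invPoch₂-zero : ∀ j → invPoch₂ 0 j ≡ 1₂ j
invPoch₂-zero zero    = refl
invPoch₂-zero (suc j) = refl

invPoch₂-pred : ∀ m j → invPoch₂ m j ≡ (invPoch₂ (suc m) ⊕ q^ suc m · invPoch₂ (suc m)) j
invPoch₂-pred m j = sym (begin
  invPoch₂ (suc m) j xor (q^ suc m · invPoch₂ (suc m)) j
    ≡⟨ cong₂ _xor_ (product j) (q^-cong (suc m) j (λ i _ → product i)) ⟩
  (invPoch₂ m ✶ geometric m) j xor (q^ suc m · (invPoch₂ m ✶ geometric m)) j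
    ≡⟨ cong ((invPoch₂ m ✶ geometric m) j xor_) (✶-q^ʳ (suc m) (invPoch₂ m) (geometric m) j) ⟨
  (invPoch₂ m ✶ geometric m) j xor (invPoch₂ m ✶ (q^ suc m · geometric m)) j
    ≡⟨ ✶-distribˡ (invPoch₂ m) (geometric m) (q^ suc m · geometric m) j ⟨
  (invPoch₂ m ✶ (geometric m ⊕ q^ suc m · geometric m)) j
    ≡⟨ ✶-congʳ j (invPoch₂ m) (λ i _ → geometric-inverse m i) ⟩
  (invPoch₂ m ✶ 1₂) j
    ≡⟨ ✶-identityʳ (invPoch₂ m) j ⟩
  invPoch₂ m j ∎)
  where
  open ≡-Reasoning
  product : ∀ i → invPoch₂ (suc m) i ≡ (invPoch₂ m ✶ geometric m) i
  product = odd-⋆ (invPoch m) (invOnePlusQPow m)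

invPoch₂-suc : ∀ m j → invPoch₂ (suc m) j ≡ (invPoch₂ m ⊕ q^ suc m · invPoch₂ (suc m)) j
invPoch₂-suc m j = trans (xor-cancelʳ (invPoch₂ (suc m) j) _) (cong (_xor (q^ suc m · invPoch₂ (suc m)) j) (sym (invPoch₂-pred m j)))

-- The factor 1/(1 + q^(m+1)) is 1 up to degree m, so from index `j` on the coefficient is that of
-- 1/(-q;q)_∞.
invPoch₂-stable : ∀ {m n j} → j ≤ m → j ≤ n → invPoch₂ m j ≡ invPoch₂ n j
invPoch₂-stable {m} {n} {j} j≤m j≤n = trans (to-j m j≤m) (sym (to-j n j≤n))
  where
  to-j : ∀ m → j ≤ m → invPoch₂ m j ≡ invPoch₂ j j
  to-j zero    z≤n = refl
  to-j (suc m) le with m≤n⇒m<n∨m≡n le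
  ... | inj₂ refl    = refl
  ... | inj₁ (s≤s l) = trans (invPoch₂-suc m j)
          (trans (cong (invPoch₂ m j xor_) (q^-low (invPoch₂ (suc m)) (s≤s l)))
                 (trans (xor-identityʳ _) (to-j m l)))

-- Both are finite products, so the factors 1 + q^i cancel one at a time and no bound on the degree
-- arises.
distinctSeries-invPoch₂ : ∀ M j → (distinctSeries M 0 ✶ invPoch₂ M) j ≡ 1₂ j
distinctSeries-invPoch₂ zero    j = trans (✶-congʳ j (distinctSeries 0 0) (λ i _ → invPoch₂-zero i))
  (trans (✶-identityʳ (distinctSeries 0 0) j) (distinctSeries-zero 0 j))
distinctSeries-invPoch₂ (suc M) j = begin
  (distinctSeries (suc M) 0 ✶ P) j
    ≡⟨ ✶-congˡ j P (λ i _ → trans (distinctSeries-suc M 0 i)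
         (cong (D i xor_) (q^-exponent (+-identityʳ (suc M)) D i))) ⟩
  ((D ⊕ q^ suc M · D) ✶ P) j
    ≡⟨ ✶-distribʳ D (q^ suc M · D) P j ⟩
  (D ✶ P) j xor ((q^ suc M · D) ✶ P) j
    ≡⟨ cong ((D ✶ P) j xor_) (trans (✶-q^ˡ (suc M) D P j) (sym (✶-q^ʳ (suc M) D P j))) ⟩
  (D ✶ P) j xor (D ✶ (q^ suc M · P)) j
    ≡⟨ ✶-distribˡ D P (q^ suc M · P) j ⟨
  (D ✶ (P ⊕ q^ suc M · P)) j
    ≡⟨ ✶-congʳ j D (λ i _ → invPoch₂-pred M i) ⟨
  (D ✶ invPoch₂ M) j
    ≡⟨ distinctSeries-invPoch₂ M j ⟩
  1₂ j ∎
  where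
  open ≡-Reasoning
  D = distinctSeries M 0
  P = invPoch₂ (suc M)

-- The sums W_n and their recurrence

sq : ℕ → ℕ
sq d = d * d

n≤sq : ∀ n → n ≤ sq n
n≤sq zero    = z≤n
n≤sq (suc n) = m≤m+n (suc n) (n * suc n)

-- With a = i - N this is a² + 2a + 1 = (a + 1)², with 2N added to both sides. It turns splitting a
-- denominator into the shift from a to a + 1.
sq-shift : ∀ i N → sq ∣ i - N ∣ + suc (2 * i) ≡ 2 * N + sq ∣ suc i - N ∣
sq-shift zero    zero    = refl
sq-shift zero    (suc N) = ring N
  where
  ring : ∀ N → suc N * suc N + 1 ≡ 2 * suc N + N * N
  ring = solve-∀
sq-shift (suc i) zero    = ring i
  where
  ring : ∀ i → suc i * suc i + suc (2 * suc i) ≡ suc (suc i) * suc (suc i)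
  ring = solve-∀
sq-shift (suc i) (suc N) = trans (ring₁ (sq ∣ i - N ∣) i)
  (trans (cong (λ e → suc (suc e)) (sq-shift i N)) (ring₂ (sq ∣ suc i - N ∣) N))
  where
  ring₁ : ∀ e i → e + suc (2 * suc i) ≡ 2 + (e + suc (2 * i))
  ring₁ = solve-∀
  ring₂ : ∀ e N → 2 + (2 * N + e) ≡ 2 * suc N + e
  ring₂ = solve-∀

-- With i = a + N this is Σ_{a ≥ −N} q^{a²} / (−q;q)_{2a+2N}; χ-sum N is Σ_{a > −N} q^{a²} / (−q;q)_{2a+2N−1}.
-- Both are cut off at i ≤ B.
X-sum : ℕ → ℕ → Series₂
X-sum N B j = ∑ B (λ i → (q^ sq ∣ i - N ∣ · invPoch₂ (2 * i)) j)

χ-sum : ℕ → ℕ → Series₂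
χ-sum N B j = ∑ B (λ i → (q^ sq ∣ suc i - N ∣ · invPoch₂ (suc (2 * i))) j)

invPoch₂-split : ∀ e m j →
  (q^ e · invPoch₂ (suc m)) j ≡ (q^ e · invPoch₂ m ⊕ q^ e + suc m · invPoch₂ (suc m)) j
invPoch₂-split e m j = trans (q^-cong e j (λ i _ → invPoch₂-suc m i))
  (trans (q^-⊕ e (invPoch₂ m) _ j) (cong ((q^ e · invPoch₂ m) j xor_) (q^-q^ e (suc m) (invPoch₂ (suc m)) j)))

-- The recurrence W_{2N+2} = W_{2N+1} + q^{2N} W_{2N}: splitting off the last factor of each
-- denominator leaves the first sum, and `sq-shift` identifies the remainder.
χ-sum-step : ∀ N B j → χ-sum (suc N) B j ≡ (X-sum N B ⊕ q^ 2 * N · χ-sum N B) j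
χ-sum-step N B j = begin
  χ-sum (suc N) B j
    ≡⟨ ∑-cong B (λ i _ → invPoch₂-split (sq ∣ i - N ∣) (2 * i) j) ⟩
  ∑ B (λ i → (q^ sq ∣ i - N ∣ · invPoch₂ (2 * i)) j xor (q^ sq ∣ i - N ∣ + suc (2 * i) · invPoch₂ (suc (2 * i))) j)
    ≡⟨ ∑-xor B _ _ ⟩
  X-sum N B j xor ∑ B (λ i → (q^ sq ∣ i - N ∣ + suc (2 * i) · invPoch₂ (suc (2 * i))) j)
    ≡⟨ cong (X-sum N B j xor_) (∑-cong B (λ i _ → trans
         (q^-exponent (sq-shift i N) (invPoch₂ (suc (2 * i))) j)
         (sym (q^-q^ (2 * N) (sq ∣ suc i - N ∣) (invPoch₂ (suc (2 * i))) j)))) ⟩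
  X-sum N B j xor ∑ B (λ i → (q^ 2 * N · q^ sq ∣ suc i - N ∣ · invPoch₂ (suc (2 * i))) j)
    ≡⟨ cong (X-sum N B j xor_) (q^-∑ (2 * N) B (λ i → q^ sq ∣ suc i - N ∣ · invPoch₂ (suc (2 * i))) j) ⟨
  X-sum N B j xor (q^ 2 * N · χ-sum N B) j ∎
  where open ≡-Reasoning

-- The recurrence W_{2N+3} = W_{2N+2} + q^{2N+1} W_{2N+1}. The term i = 0 has an empty denominator
-- and cannot be split; it matches directly by (N + 1)² = 2N + 1 + N². Splitting the others lowers
-- the index by one, hence the cut-offs `B` and `suc B`.
X-sum-step : ∀ N B j →
  X-sum (suc N) (suc B) j ≡ (χ-sum (suc N) B ⊕ q^ suc (2 * N) · X-sum N (suc B)) j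
X-sum-step N B j = begin
  X-sum (suc N) (suc B) j
    ≡⟨ ∑-head B _ ⟩
  (q^ sq (suc N) · P 0) j xor ∑ B (λ i → (q^ sq ∣ i - N ∣ · P (2 * suc i)) j)
    ≡⟨ cong₂ _xor_ head (∑-cong B (λ i _ → tail i)) ⟩
  (q^ c · q^ sq N · P 0) j xor ∑ B (λ i → (q^ sq ∣ i - N ∣ · P (suc (2 * i))) j xor (q^ c · q^ sq ∣ suc i - N ∣ · P (2 * suc i)) j)
    ≡⟨ cong ((q^ c · q^ sq N · P 0) j xor_) (∑-xor B _ _) ⟩
  (q^ c · q^ sq N · P 0) j xor (χ-sum (suc N) B j xor ∑ B (λ i → (q^ c · q^ sq ∣ suc i - N ∣ · P (2 * suc i)) j))
    ≡⟨ rotate ((q^ c · q^ sq N · P 0) j) (χ-sum (suc N) B j) _ ⟩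
  χ-sum (suc N) B j xor ((q^ c · q^ sq N · P 0) j xor ∑ B (λ i → (q^ c · q^ sq ∣ suc i - N ∣ · P (2 * suc i)) j))
    ≡⟨ cong (χ-sum (suc N) B j xor_) (trans
         (q^-∑ c (suc B) (λ i → q^ sq ∣ i - N ∣ · P (2 * i)) j)
         (∑-head B (λ i → (q^ c · q^ sq ∣ i - N ∣ · P (2 * i)) j))) ⟨
  χ-sum (suc N) B j xor (q^ c · X-sum N (suc B)) j ∎
  where
  open ≡-Reasoning
  P = invPoch₂
  c = suc (2 * N)

  rotate : ∀ x y z → x xor (y xor z) ≡ y xor (x xor z)
  rotate = solve 3 (λ x y z → x :+ (y :+ z) := y :+ (x :+ z)) refl
    where open xor-∧-Solver

  square : ∀ N → suc N * suc N ≡ suc (2 * N) + N * N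
  square = solve-∀

  head : (q^ sq (suc N) · P 0) j ≡ (q^ c · q^ sq N · P 0) j
  head = trans (q^-exponent (square N) (P 0) j) (sym (q^-q^ c (sq N) (P 0) j))

  exponent : ∀ i → sq ∣ i - N ∣ + suc (suc (2 * i)) ≡ c + sq ∣ suc i - N ∣
  exponent i = trans (+-suc (sq ∣ i - N ∣) (suc (2 * i))) (cong suc (sq-shift i N))

  tail : ∀ i → (q^ sq ∣ i - N ∣ · P (2 * suc i)) j ≡
    (q^ sq ∣ i - N ∣ · P (suc (2 * i))) j xor (q^ c · q^ sq ∣ suc i - N ∣ · P (2 * suc i)) j
  tail i = subst
    (λ m → (q^ sq ∣ i - N ∣ · P m) j ≡ (q^ sq ∣ i - N ∣ · P (suc (2 * i))) j xor (q^ c · q^ sq ∣ suc i - N ∣ · P m) j)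
    (sym (*-suc 2 i))
    (trans (invPoch₂-split (sq ∣ i - N ∣) (suc (2 * i)) j)
      (cong ((q^ sq ∣ i - N ∣ · P (suc (2 * i))) j xor_)
        (trans (q^-exponent (exponent i) (P (suc (suc (2 * i)))) j)
               (sym (q^-q^ c (sq ∣ suc i - N ∣) (P (suc (suc (2 * i)))) j)))))

∑-agree : ∀ {m n f} → (∀ i → m < i → f i ≡ false) → (∀ i → n < i → f i ≡ false) → ∑ m f ≡ ∑ n f
∑-agree {m} {n} zero-m zero-n with ≤-total m n
... | inj₁ m≤n = sym (∑-extend m≤n zero-m)
... | inj₂ n≤m = ∑-extend n≤m zero-n

X₂ χ₂ : Series₂
X₂ j = odd (cX j)
χ₂ j = odd (cχ j)

odd-signed-shift : ∀ n a f j → odd (scale (sgn n) (shift a f) j) ≡ (q^ a · (odd ∘ f)) j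
odd-signed-shift n a f j = trans (odd-* (sgn n) (shift a f j))
  (trans (cong (_∧ odd (shift a f j)) (odd-sgn n)) (odd-shift a f j))

X₂-as-sum : ∀ j B → j ≤ B → X₂ j ≡ X-sum 0 B j
X₂-as-sum j B le = trans (odd-sumTo j (λ n → Xterm n j)) (trans
  (∑-cong j (λ i _ → trans (odd-signed-shift i (i * i) (invPoch (2 * i)) j)
    (q^-exponent (cong sq (sym (∣-∣-identityʳ i))) (invPoch₂ (2 * i)) j)))
  (sym (∑-extend le (λ i j<i → q^-low (invPoch₂ (2 * i))
    (<-≤-trans j<i (subst (λ d → i ≤ sq d) (sym (∣-∣-identityʳ i)) (n≤sq i)))))))

χ₂-as-sum : ∀ j B → j ≤ suc B → χ₂ j ≡ χ-sum 0 B j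
χ₂-as-sum j B le = trans (odd-sumTo j (λ n → χterm n j)) (trans
  (∑-cong j (λ i _ → odd-signed-shift i (suc i * suc i) (invPoch (suc (2 * i))) j))
  -- Exponents start at 1², so `j` may be B + 1 and either cut-off can be the larger one.
  (∑-agree (λ i j<i → vanish i (<-trans j<i (n<1+n i))) (λ i B<i → vanish i (≤-<-trans le (s≤s B<i)))))
  where
  vanish : ∀ i → j < suc i → (q^ sq (suc i) · invPoch₂ (suc (2 * i))) j ≡ false
  vanish i lt = q^-low (invPoch₂ (suc (2 * i))) (<-≤-trans lt (n≤sq (suc i)))

mutual
  -- The bound keeps the cut-off harmless: an index i > B has i + 1 - N > j, and the exponent is its
  -- square. In `forward-odd` the exponent is (i - N)², whence the bound smaller by one.
  forward-even : ∀ N j B → N + j ≤ suc B → forward χ₂ X₂ (2 * N) j ≡ χ-sum N B j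
  forward-even zero    j B le = χ₂-as-sum j B le
  forward-even (suc N) j B (s≤s le) = begin
    forward χ₂ X₂ (2 * suc N) j
      ≡⟨ cong (λ n → forward χ₂ X₂ n j) (*-suc 2 N) ⟩
    forward χ₂ X₂ (suc (2 * N)) j xor (q^ 2 * N · forward χ₂ X₂ (2 * N)) j
      ≡⟨ cong₂ _xor_ (forward-odd N j B le)
           (q^-cong (2 * N) j (λ i l → forward-even N i B
             (m≤n⇒m≤1+n (≤-trans (+-monoʳ-≤ N (≤-trans (m≤n+m i (2 * N)) l)) le)))) ⟩
    X-sum N B j xor (q^ 2 * N · χ-sum N B) j
      ≡⟨ χ-sum-step N B j ⟨
    χ-sum (suc N) B j ∎
    where open ≡-Reasoning

  forward-odd : ∀ N j B → N + j ≤ B → forward χ₂ X₂ (suc (2 * N)) j ≡ X-sum N B j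
  forward-odd zero    j B       le = X₂-as-sum j B le
  forward-odd (suc N) j (suc B) le@(s≤s le′) = begin
    forward χ₂ X₂ (suc (2 * suc N)) j
      ≡⟨ cong (λ n → forward χ₂ X₂ (suc n) j) (*-suc 2 N) ⟩
    forward χ₂ X₂ (suc (suc (2 * N))) j xor (q^ suc (2 * N) · forward χ₂ X₂ (suc (2 * N))) j
      ≡⟨ cong₂ _xor_
           (trans (cong (λ n → forward χ₂ X₂ n j) (sym (*-suc 2 N))) (forward-even (suc N) j B le))
           (q^-cong (suc (2 * N)) j (λ i l → forward-odd N i (suc B)
             (m≤n⇒m≤1+n (≤-trans (+-monoʳ-≤ N (≤-trans (m≤n+m i (suc (2 * N))) l)) le′)))) ⟩
    χ-sum (suc N) B j xor (q^ suc (2 * N) · X-sum N (suc B)) j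
      ≡⟨ X-sum-step N B j ⟨
    X-sum (suc N) (suc B) j ∎
    where open ≡-Reasoning

-- Indices i and 2N - i cancel modulo 2; the induction strips the two ends.
∑-symmetric : ∀ N (h : ℕ → Bool) → ∑ (2 * N) (λ i → h ∣ i - N ∣) ≡ h 0
∑-symmetric zero    h = refl
∑-symmetric (suc N) h = begin
  ∑ (2 * suc N) (λ i → h ∣ i - suc N ∣)
    ≡⟨ cong (λ n → ∑ n (λ i → h ∣ i - suc N ∣)) (*-suc 2 N) ⟩
  ∑ (suc (2 * N)) (λ i → h ∣ i - suc N ∣) xor h ∣ suc (2 * N) - N ∣
    ≡⟨ cong₂ _xor_ (∑-head (2 * N) (λ i → h ∣ i - suc N ∣)) (cong h last) ⟩
  (h (suc N) xor ∑ (2 * N) (λ i → h ∣ i - N ∣)) xor h (suc N)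
    ≡⟨ cong (λ x → (h (suc N) xor x) xor h (suc N)) (∑-symmetric N h) ⟩
  (h (suc N) xor h 0) xor h (suc N)
    ≡⟨ cancel (h (suc N)) (h 0) ⟩
  h 0 ∎
  where
  open ≡-Reasoning
  cancel : ∀ x y → (x xor y) xor x ≡ y
  cancel = solve 2 (λ x y → (x :+ y) :+ x := y) refl
    where open xor-∧-Solver
  double : ∀ N → suc (2 * N) ≡ N + suc N
  double = solve-∀
  last : ∣ suc (2 * N) - N ∣ ≡ suc N
  last = trans (∣-∣-comm (suc (2 * N)) N) (trans (cong ∣ N -_∣ (double N)) (∣m-m+n∣≡n N (suc N)))

-- In degrees ≤ N every invPoch₂ (2i) may be replaced by invPoch₂ (2N), after which the terms
-- a and −a cancel and only a = 0 is left.
forward-limit : ∀ N j → j ≤ N → forward χ₂ X₂ (suc (2 * N)) j ≡ invPoch₂ (2 * N) j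
forward-limit N j j≤N = begin
  forward χ₂ X₂ (suc (2 * N)) j
    ≡⟨ forward-odd N j (2 * N) (+-monoʳ-≤ N (≤-trans j≤N (m≤m+n N 0))) ⟩
  X-sum N (2 * N) j
    ≡⟨ ∑-cong (2 * N) (λ i _ → q^-cong (sq ∣ i - N ∣) j (λ t le → invPoch₂-stable
         (≤-trans (small i t le) (m≤m+n i (i + 0)))
         (≤-trans (m≤n+m t (sq ∣ i - N ∣)) (≤-trans le (≤-trans j≤N (m≤m+n N (N + 0))))))) ⟩
  ∑ (2 * N) (λ i → (q^ sq ∣ i - N ∣ · invPoch₂ (2 * N)) j)
    ≡⟨ ∑-symmetric N (λ d → (q^ sq d · invPoch₂ (2 * N)) j) ⟩
  invPoch₂ (2 * N) j ∎
  where
  open ≡-Reasoning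
  -- Since ∣i - N∣ is at most its square, N ≤ i + (i - N)²; with (i - N)² + t ≤ N this gives t ≤ i.
  small : ∀ i t → sq ∣ i - N ∣ + t ≤ j → t ≤ i
  small i t le = +-cancelˡ-≤ (sq ∣ i - N ∣) t i
    (≤-trans le (≤-trans j≤N (≤-trans (m≤n+∣m-n∣ N i)
      (≤-trans (+-monoʳ-≤ i (subst (λ d → d ≤ sq ∣ i - N ∣) (∣-∣-comm i N) (n≤sq ∣ i - N ∣)))
               (≤-reflexive (+-comm i (sq ∣ i - N ∣)))))))

-- Parities of the counts, limits and conclusion

-- The inner filter comes first in the conjunction, so that for `b` and `b₁` the result is
-- `nonRascoe` at k = 0 by computation.
odd-count : {P Q : List ℕ → Set} (P? : Decidable P) (Q? : Decidable Q) → ∀ n →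
  oddℕ (length (filter P? (filter Q? (subsetsUpTo n)))) ≡ ⨁ n (λ p → does (Q? p) ∧ does (P? p))
odd-count P? Q? n = trans (lengths (subsetsUpTo n)) (subsets n _)
  where
  parity : (List ℕ → Bool) → List (List ℕ) → Bool
  parity f []       = false
  parity f (p ∷ ps) = f p xor parity f ps

  lengths : ∀ ps → oddℕ (length (filter P? (filter Q? ps))) ≡ parity (λ p → does (Q? p) ∧ does (P? p)) ps
  lengths []       = refl
  lengths (p ∷ ps) with does (Q? p)
  ... | false = lengths ps
  ... | true with does (P? p)
  ...   | false = lengths ps
  ...   | true  = cong not (lengths ps)

  parity-++ : ∀ f ps qs → parity f (ps ++ qs) ≡ parity f ps xor parity f qs
  parity-++ f []       qs = refl
  parity-++ f (p ∷ ps) qs = trans (cong (f p xor_) (parity-++ f ps qs)) (sym (xor-assoc (f p) _ _))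

  parity-map : ∀ f (g : List ℕ → List ℕ) ps → parity f (map g ps) ≡ parity (f ∘ g) ps
  parity-map f g []       = refl
  parity-map f g (p ∷ ps) = cong (f (g p) xor_) (parity-map f g ps)

  subsets : ∀ n f → parity f (subsetsUpTo n) ≡ ⨁ n f
  subsets zero    f = xor-identityʳ (f [])
  subsets (suc n) f = trans (parity-++ f (subsetsUpTo n) _) (cong₂ _xor_ (subsets n f)
    (trans (parity-map f (suc n ∷_) (subsetsUpTo n)) (subsets n (f ∘ (suc n ∷_)))))

nonRascoe-stable : ∀ M ℓ j → j ≤ M → nonRascoe M ℓ 0 j ≡ nonRascoe j ℓ 0 j
nonRascoe-stable M ℓ j le = ⨁-extend le
  (λ p lt → cong (_∧ not ((ℓ + length p) ∈ᵇ p)) (≢⇒≡ᵇ-false (>⇒≢ lt)))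

odd-b : ∀ M j → j ≤ M → oddℕ (b j) ≡ nonRascoe M 0 0 j
odd-b M j le = trans (odd-count (λ p → ¬? (length p ∈? p)) (λ p → sum p ≟ j) j)
  (sym (nonRascoe-stable M 0 j le))

odd-b₁ : ∀ M j → j ≤ M → oddℕ (b₁ j) ≡ nonRascoe M 1 0 j
odd-b₁ M j le = trans (odd-count (λ p → ¬? (suc (length p) ∈? p)) (λ p → sum p ≟ j) j)
  (sym (nonRascoe-stable M 1 j le))

-- The correction for partitions containing their forbidden part starts at q^(ℓ+1), beyond degree
-- `j`.
nonRascoe-limit : ∀ M ℓ j → j ≤ M → j ≤ ℓ → nonRascoe M ℓ 0 j ≡ distinctSeries M 0 j
nonRascoe-limit M ℓ j j≤M j≤ℓ = trans (nonRascoe-step M ℓ 0 j j≤M)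
  (trans (cong (distinctSeries M 0 j xor_)
           (q^-low (nonRascoe M (suc ℓ) 1) (s≤s (≤-trans j≤ℓ (m≤m+n ℓ 0)))))
         (xor-identityʳ _))

theorem5p3 : ∀ (k : ℕ) → 1 ≤ k →
    (+ 2) ∣ sumTo k (λ n → (+ b n) ℤ.* cX (k ∸ n) ℤ.+ (+ b₁ n) ℤ.* cχ (k ∸ n))
theorem5p3 k@(suc k′) (s≤s _) = even⇒2∣ (sumTo k _) (begin
  odd (sumTo k (λ n → (+ b n) ℤ.* cX (k ∸ n) ℤ.+ (+ b₁ n) ℤ.* cχ (k ∸ n)))
    ≡⟨ odd-sumTo k _ ⟩
  ∑ k (λ n → odd ((+ b n) ℤ.* cX (k ∸ n) ℤ.+ (+ b₁ n) ℤ.* cχ (k ∸ n)))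
    ≡⟨ ∑-cong k (λ n n≤k → trans (odd-+ ((+ b n) ℤ.* cX (k ∸ n)) _) (cong₂ _xor_
         (trans (odd-* (+ b n) (cX (k ∸ n))) (cong (_∧ X₂ (k ∸ n)) (odd-b M n (≤-trans n≤k k≤M))))
         (trans (odd-* (+ b₁ n) (cχ (k ∸ n))) (cong (_∧ χ₂ (k ∸ n)) (odd-b₁ M n (≤-trans n≤k k≤M)))))) ⟩
  ∑ k (λ n → (f 0 n ∧ X₂ (k ∸ n)) xor (f 1 n ∧ χ₂ (k ∸ n)))
    ≡⟨ ∑-xor k _ _ ⟩
  ∑ k (λ n → f 0 n ∧ X₂ (k ∸ n)) xor ∑ k (λ n → f 1 n ∧ χ₂ (k ∸ n))
    ≡⟨ cong₂ _xor_ (✶-as-∑ (f 0) X₂ k) (✶-as-∑ (f 1) χ₂ k) ⟩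
  casoratian f w 0 k
    ≡⟨ casoratian-constant f χ₂ X₂ k (λ n i i≤k → nonRascoe-recurrence M n i (≤-trans i≤k k≤M)) M ⟩
  (f M ✶ w (suc M)) k xor (q^ M · (f (suc M) ✶ w M)) k
    ≡⟨ cong₂ _xor_
         (✶-cong k (λ i i≤k → nonRascoe-limit M M i (≤-trans i≤k k≤M) (≤-trans i≤k k≤M)) (forward-limit k))
         -- At index `M > k` the factor q^M removes the second product from degree `k`.
         (q^-low (f (suc M) ✶ w M) k<M) ⟩
  (distinctSeries M 0 ✶ invPoch₂ M) k xor false
    -- The invariant is the series 1, whose coefficient in degree `k` vanishes because `k ≥ 1`.
    ≡⟨ trans (xor-identityʳ _) (distinctSeries-invPoch₂ M k) ⟩
  false ∎)
  where
  open ≡-Reasoning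
  -- One number serves as truncation and as index of the invariant; it is even so that `w (suc M)`
  -- has the form treated by `forward-limit`.
  M = 2 * k
  k<M : k < M
  k<M = m<m+n k (s≤s z≤n)
  k≤M : k ≤ M
  k≤M = <⇒≤ k<M
  f = λ n → nonRascoe M n 0
  w = forward χ₂ X₂
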